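{- Let $U$ be a nonempty set, $\varphi$ an MSO formula, and $X,Z$ second-order variables such that $Z$ is substitutable for $X$ in $\varphi$. Then for every interpretation $I$ over $U$, all $D\subseteq U$, $E\subseteq\mathcal P(U)$, $g:V\to U$ with $\mathrm{Range}(g)\subseteq D$ and $G:V_2\to\mathcal P(U)$ with $\mathrm{Range}(G)\subseteq E$, $$\langle I,D,E\rangle,g,G\models^d[X\leftarrow Z](\varphi)\iff\langle I,D,E\rangle,g,G\langle X\leftarrow G(Z)\rangle\models^d\varphi .$$
   Context: **Syntax.** Relation symbols $R=\mathbb N$, first-order variables $V=\mathbb N$ and second-order (monadic) variables $V_2=\mathbb N$ (the two kinds of variables form separate namespaces). MSO formulas: $\varphi,\psi ::= r(x,y)\mid X(x)\mid\neg\varphi\mid\varphi\wedge\psi\mid\exists x.\varphi\mid\exists X.\varphi$ with $r\in R$, $x,y\in V$, $X\in V_2$ (no equality). **Semantics.** $U$ is a fixed nonempty set (the type of individuals). An interpretation $I$ over $U$ assigns to each $r\in R$ a binary relation $I(r)\subseteq U\times U$. Given $I$, $D\subseteq U$, $E\subseteq\mathcal P(U)$, $g:V\to U$, $G:V_2\to\mathcal P(U)$, truth $\langle I,D,E\rangle,g,G\models^d\varphi$ is defined recursively: $r(x,y)$ holds iff $(g(x),g(y))\in I(r)$; $X(x)$ holds iff $g(x)\in G(X)$; $\neg,\wedge$ are classical; $\exists x.\varphi$ holds iff $\langle I,D,E\rangle,g[x\leftarrow d],G\models^d\varphi$ for some $d\in D$; $\exists X.\varphi$ holds iff $\langle I,D,E\rangle,g,G\langle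 X\leftarrow S\rangle\models^d\varphi$ for some $S\in E$. Here $g[x\leftarrow d]$ and $G\langle X\leftarrow S\rangle$ are the usual updates. **Substitution.** $[X\leftarrow Z](\varphi)$ is the result of replacing all free occurrences of the second-order variable $X$ in $\varphi$ by $Z$ (no renaming; first-order binders are transparent, i.e. simply descended through). $Z$ is substitutable for $X$ in $\varphi$ if no free occurrence of $X$ in $\varphi$ lies in the scope of a binder $\exists Z$. -}

module Defs where

open import Level using (Level; _⊔_; Lift) renaming (suc to lsuc)
open import Data.Bool using (if_then_else_)
open import Data.Nat using (ℕ; _≟_)
open import Data.Product using (∃; _×_)
open import Data.Sum using (_⊎_)
open import Data.Empty using (⊥)
open import Relation.Nullary using (¬_; does)
open import Relation.Binary.Core using (Rel)
open import Relation.Binary.PropositionalEquality using (_≡_; _≢_)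
open import Relation.Unary using (Pred; _∈_)

private
  variable
    a u ℓ e : Level

RelSym Var Var₂ : Set
RelSym = ℕ
Var    = ℕ
Var₂   = ℕ

infixr 8 ¬̇_
infixr 7 _∧̇_
infixr 6 ∃₁_∙_ ∃₂_∙_

data Formula : Set where
  rel   : RelSym → Var → Var → Formula
  mem   : Var₂ → Var → Formula
  ¬̇_    : Formula → Formula
  _∧̇_   : Formula → Formula → Formula
  ∃₁_∙_ : Var → Formula → Formula
  ∃₂_∙_ : Var₂ → Formula → Formula

infixl 10 _[_←_]

_[_←_] : {A : Set a} → (ℕ → A) → ℕ → A → (ℕ → A)
(f [ x ← v ]) y = if does (y ≟ x) then v else f y

Range : {A : Set a} → (ℕ → A) → Pred A a
Range f v = ∃ λ x → f x ≡ v

Interpretation : Set u → (ℓ : Level) → Set (u ⊔ lsuc ℓ)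
Interpretation U ℓ = RelSym → Rel U ℓ

infix 4 ⟨_⨾_⨾_⟩_⨾_⊨ᵈ_

-- Subsets are predicates of a fixed level ℓ, so quantifying over them raises
-- the level; atoms are lifted to give all formulas truth values in one universe.
-- E need not respect extensional equality of predicates.
⟨_⨾_⨾_⟩_⨾_⊨ᵈ_ : {U : Set u} →
  Interpretation U ℓ → Pred U ℓ → Pred (Pred U ℓ) e →
  (Var → U) → (Var₂ → Pred U ℓ) → Formula → Set (u ⊔ lsuc ℓ ⊔ e)
⟨ I ⨾ D ⨾ E ⟩ g ⨾ G ⊨ᵈ rel r x y  = Lift _ (I r (g x) (g y))
⟨ I ⨾ D ⨾ E ⟩ g ⨾ G ⊨ᵈ mem X x    = Lift _ (g x ∈ G X)
⟨ I ⨾ D ⨾ E ⟩ g ⨾ G ⊨ᵈ ¬̇ φ        = ¬ (⟨ I ⨾ D ⨾ E ⟩ g ⨾ G ⊨ᵈ φ)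
⟨ I ⨾ D ⨾ E ⟩ g ⨾ G ⊨ᵈ φ ∧̇ ψ      = (⟨ I ⨾ D ⨾ E ⟩ g ⨾ G ⊨ᵈ φ) × (⟨ I ⨾ D ⨾ E ⟩ g ⨾ G ⊨ᵈ ψ)
⟨ I ⨾ D ⨾ E ⟩ g ⨾ G ⊨ᵈ (∃₁ x ∙ φ) = ∃ λ d → d ∈ D × (⟨ I ⨾ D ⨾ E ⟩ g [ x ← d ] ⨾ G ⊨ᵈ φ)
⟨ I ⨾ D ⨾ E ⟩ g ⨾ G ⊨ᵈ (∃₂ X ∙ φ) = ∃ λ S → S ∈ E × (⟨ I ⨾ D ⨾ E ⟩ g ⨾ G [ X ← S ] ⊨ᵈ φ)

-- An occurrence below ∃₂ X is bound by it, so substitution stops there.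
substVar₂ : Var₂ → Var₂ → Formula → Formula
substVar₂ X Z (rel r x y) = rel r x y
substVar₂ X Z (mem Y x)   = mem (if does (Y ≟ X) then Z else Y) x
substVar₂ X Z (¬̇ φ)       = ¬̇ substVar₂ X Z φ
substVar₂ X Z (φ ∧̇ ψ)     = substVar₂ X Z φ ∧̇ substVar₂ X Z ψ
substVar₂ X Z (∃₁ x ∙ φ)  = ∃₁ x ∙ substVar₂ X Z φ
substVar₂ X Z (∃₂ Y ∙ φ)  = ∃₂ Y ∙ (if does (Y ≟ X) then φ else substVar₂ X Z φ)

-- The inhabitants of FreeOcc X φ are the individual free occurrences of X in φ,
-- each given by the path leading to it.
data FreeOcc (X : Var₂) : Formula → Set where
  here   : ∀ {x} → FreeOcc X (mem X x)
  under¬ : ∀ {φ} → FreeOcc X φ → FreeOcc X (¬̇ φ)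
  left   : ∀ {φ ψ} → FreeOcc X φ → FreeOcc X (φ ∧̇ ψ)
  right  : ∀ {φ ψ} → FreeOcc X ψ → FreeOcc X (φ ∧̇ ψ)
  under₁ : ∀ {x φ} → FreeOcc X φ → FreeOcc X (∃₁ x ∙ φ)
  under₂ : ∀ {Y φ} → Y ≢ X → FreeOcc X φ → FreeOcc X (∃₂ Y ∙ φ)

InScopeOf : Var₂ → ∀ {X φ} → FreeOcc X φ → Set
InScopeOf Z here                 = ⊥
InScopeOf Z (under¬ o)           = InScopeOf Z o
InScopeOf Z (left o)             = InScopeOf Z o
InScopeOf Z (right o)            = InScopeOf Z o
InScopeOf Z (under₁ o)           = InScopeOf Z o
InScopeOf Z (under₂ {Y = Y} _ o) = Y ≡ Z ⊎ InScopeOf Z o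

SubstitutableFor : Var₂ → Var₂ → Formula → Set
SubstitutableFor Z X φ = (o : FreeOcc X φ) → ¬ InScopeOf Z o

{-# OPTIONS --safe #-}
-- Truth depends only on the values of the free second-order variables.  So the
-- claim is generalised to any H that agrees with G after renaming X to Z on the
-- free variables of φ: unlike pointwise equality of H with G ⟨ X ← G Z ⟩, this
-- survives a binder ∃₂ Z, below which substitutability leaves no free X.
module Submission where

open import Level using (Level; Lift)
open import Relation.Unary using (Pred; _⊆_)
open import Function.Base using (_∘_; id)
open import Function.Bundles using (_⇔_)
open import Function.Construct.Identity using (⇔-id; ↔-id)
open import Function.Related.Propositional using (≡⇒)
open import Function.Related.TypeIsomorphisms using (¬-cong-⇔)
open import Data.Nat using (ℕ; _≟_)
open import Data.Product using (∃; _×_)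
open import Data.Product.Function.Dependent.Propositional using () renaming (cong to Σ-cong)
open import Data.Product.Function.NonDependent.Propositional using (_×-⇔_)
open import Data.Sum using (inj₁; inj₂)
open import Relation.Nullary using (yes; no)
open import Relation.Nullary.Decidable using (dec-true; dec-false)
open import Relation.Binary.PropositionalEquality
  using (_≡_; _≢_; refl; sym; trans; cong; ≢-sym)
open import Defs

private
  variable
    a : Level
    A : Set a
    φ : Formula

∃∈-cong : ∀ {i p a b} {I : Set i} (P : Pred I p) {A : Pred I a} {B : Pred I b} →
  (∀ {i} → A i ⇔ B i) → (∃ λ i → P i × A i) ⇔ (∃ λ i → P i × B i)
∃∈-cong P A⇔B = Σ-cong (↔-id _) (⇔-id _ ×-⇔ A⇔B)

update-same : (f : ℕ → A) (x : ℕ) {v : A} → (f [ x ← v ]) x ≡ v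
update-same f x rewrite dec-true (x ≟ x) refl = refl

update-other : (f : ℕ → A) {x y : ℕ} {v : A} → y ≢ x → (f [ x ← v ]) y ≡ f y
update-other f {x} {y} y≢x rewrite dec-false (y ≟ x) y≢x = refl

-- Unfolds to the same conditional as the `mem` clause of `substVar₂`, so an atom needs no case
-- split on `Y ≟ X`.
rename : Var₂ → Var₂ → Var₂ → Var₂
rename X Z = id [ X ← Z ]

AgreeOn : Formula → (G H : Var₂ → A) → Set _
AgreeOn φ G H = ∀ {Y} → FreeOcc Y φ → G Y ≡ H Y

AgreeOn-update : ∀ {G H : Var₂ → A} {Y S} →
  AgreeOn (∃₂ Y ∙ φ) G H → AgreeOn φ (G [ Y ← S ]) (H [ Y ← S ])
AgreeOn-update {G = G} {H} {Y} agree {W} o with W ≟ Y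
... | yes refl = trans (update-same G W) (sym (update-same H W))
... | no W≢Y   = trans (update-other G W≢Y)
                   (trans (agree (under₂ (≢-sym W≢Y) o)) (sym (update-other H W≢Y)))

-- At `Y` itself both sides give `S`, because `Y ≢ X` keeps the renaming from moving `Y`. Elsewhere
-- the old agreement carries over, provided that renaming sends no free variable of `φ` other than
-- `Y` to `Y`.
AgreeOn-rename-update : ∀ {G H : Var₂ → A} {X Y Z S} → Y ≢ X →
  SubstitutableFor Z X (∃₂ Y ∙ φ) → AgreeOn (∃₂ Y ∙ φ) (G ∘ rename X Z) H →
  AgreeOn φ (G [ Y ← S ] ∘ rename X Z) (H [ Y ← S ])
AgreeOn-rename-update {G = G} {H} {X} {Y} {Z} {S} Y≢X sub agree {W} o with W ≟ Y
... | yes refl = trans (cong (G [ Y ← S ]) (update-other id Y≢X))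
                   (trans (update-same G Y) (sym (update-same H Y)))
... | no W≢Y   = trans (update-other G (rename≢Y o))
                   (trans (agree (under₂ (≢-sym W≢Y) o)) (sym (update-other H W≢Y)))
  where
  rename≢Y : FreeOcc W _ → rename X Z W ≢ Y
  rename≢Y o eq with W ≟ X
  -- This would be variable capture: `Y` equals `Z`, so a free occurrence of `X` lies below `∃₂ Z`,
  -- against substitutability.
  ... | yes refl = sub (under₂ Y≢X o) (inj₁ (trans (sym eq) (update-same id W)))
  ... | no W≢X   = W≢Y (trans (sym (update-other id W≢X)) eq)

module _ {u ℓ e} {U : Set u} (I : Interpretation U ℓ) (D : Pred U ℓ) (E : Pred (Pred U ℓ) e) where

  -- Handles the binder `∃₂ X` in `substitution`, where the body is left as it stands and only the
  -- assignments differ.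
  coincidence : ∀ φ {g} {G H : Var₂ → Pred U ℓ} → AgreeOn φ G H →
    (⟨ I ⨾ D ⨾ E ⟩ g ⨾ G ⊨ᵈ φ) ⇔ (⟨ I ⨾ D ⨾ E ⟩ g ⨾ H ⊨ᵈ φ)
  coincidence (rel r x y) agree = ⇔-id _
  coincidence (mem X x) {g} agree = ≡⇒ (cong (λ P → Lift _ (P (g x))) (agree here))
  coincidence (¬̇ φ)      agree = ¬-cong-⇔ (coincidence φ (agree ∘ under¬))
  coincidence (φ ∧̇ ψ)    agree = coincidence φ (agree ∘ left) ×-⇔ coincidence ψ (agree ∘ right)
  coincidence (∃₁ x ∙ φ) agree = ∃∈-cong D (coincidence φ (agree ∘ under₁))
  coincidence (∃₂ Y ∙ φ) agree = ∃∈-cong E (coincidence φ (AgreeOn-update agree))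

  substitution : ∀ φ {X Z g} {G H : Var₂ → Pred U ℓ} → SubstitutableFor Z X φ →
    AgreeOn φ (G ∘ rename X Z) H →
    (⟨ I ⨾ D ⨾ E ⟩ g ⨾ G ⊨ᵈ substVar₂ X Z φ) ⇔ (⟨ I ⨾ D ⨾ E ⟩ g ⨾ H ⊨ᵈ φ)
  substitution (rel r x y) sub agree = ⇔-id _
  substitution (mem Y x) {g = g} sub agree = ≡⇒ (cong (λ P → Lift _ (P (g x))) (agree here))
  substitution (¬̇ φ) {G = G} sub agree =
    ¬-cong-⇔ (substitution φ {G = G} (sub ∘ under¬) (agree ∘ under¬))
  substitution (φ ∧̇ ψ) {G = G} sub agree =
    substitution φ {G = G} (sub ∘ left) (agree ∘ left) ×-⇔
    substitution ψ {G = G} (sub ∘ right) (agree ∘ right)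
  substitution (∃₁ x ∙ φ) {G = G} sub agree =
    ∃∈-cong D (substitution φ {G = G} (sub ∘ under₁) (agree ∘ under₁))
  substitution (∃₂ Y ∙ φ) {X} {Z} {G = G} {H} sub agree with Y ≟ X
  ... | yes refl rewrite dec-true (Y ≟ Y) refl =
    ∃∈-cong E (coincidence φ (AgreeOn-update agree′))
    where
    agree′ : AgreeOn (∃₂ Y ∙ φ) G H
    -- A variable free in `∃₂ Y ∙ φ` differs from `Y`, which is `X` here, so the renaming fixes it.
    agree′ o@(under₂ Y≢W _) = trans (cong G (sym (update-other id (≢-sym Y≢W)))) (agree o)
  ... | no Y≢X rewrite dec-false (Y ≟ X) Y≢X =
    -- The same `S` serves as witness on both sides. As `Y ≢ X`, free occurrences of `X` in the body
    -- stay free below the binder, so substitutability is inherited.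
    ∃∈-cong E λ {S} → substitution φ {G = G [ Y ← S ]} (λ o → sub (under₂ Y≢X o) ∘ inj₂)
      (AgreeOn-rename-update {G = G} Y≢X sub agree)

-- Starts the induction with `H` taken as `G [ X ← G Z ]`: before any binder is crossed, agreement
-- holds at every variable.
rename-agrees : (G : Var₂ → A) (X Z Y : Var₂) → G (rename X Z Y) ≡ (G [ X ← G Z ]) Y
rename-agrees G X Z Y with Y ≟ X
... | yes refl = trans (cong G (update-same id X)) (sym (update-same G X))
... | no Y≢X   = trans (cong G (update-other id Y≢X)) (sym (update-other G Y≢X))

mainTheorem8 : ∀ {u ℓ e : Level} (U : Set u) → U →
    (φ : Formula) (X Z : Var₂) → SubstitutableFor Z X φ →
    (I : Interpretation U ℓ) (D : Pred U ℓ) (E : Pred (Pred U ℓ) e)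
    (g : Var → U) → Range g ⊆ D →
    (G : Var₂ → Pred U ℓ) → Range G ⊆ E →
    (⟨ I ⨾ D ⨾ E ⟩ g ⨾ G ⊨ᵈ substVar₂ X Z φ) ⇔ (⟨ I ⨾ D ⨾ E ⟩ g ⨾ G [ X ← G Z ] ⊨ᵈ φ)
mainTheorem8 U _ φ X Z sub I D E g _ G _ =
  substitution I D E φ {G = G} sub (λ {Y} _ → rename-agrees G X Z Y)
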